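{- (i) The equation $x^4-y^4=iz^2$ has only trivial solutions in Gaussian integers, i.e., every solution $(x,y,z)\in\mathbb{Z}[i]^3$ satisfies $xyz=0$. (ii) The only nontrivial solutions $(x,y,z)\in\mathbb{Z}[i]^3$ (i.e., with $xyz\neq 0$) of the equation $x^4+y^4=iz^2$ satisfying $\gcd(x,y,z)=1$ are the triples $(x,y,z)$ with $x,y\in\{\pm i,\pm 1\}$ and $z=\pm i(1+i)$.
   Context: Here $i=\sqrt{ -1}$ and $\mathbb{Z}[i]$ denotes the ring of Gaussian integers. A solution $(x,y,z)$ of $x^4\pm y^4=cz^2$ is called trivial if $xyz=0$, and nontrivial otherwise. -}

module Defs where

open import Data.Integer as ℤ using (ℤ; +_; -[1+_])
open import Data.Product using (∃)
open import Relation.Binary.PropositionalEquality using (_≡_)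

record ℤ[i] : Set where
  constructor _+_i
  field
    re : ℤ
    im : ℤ
open ℤ[i] public

infixl 6 _+ᵍ_ _-ᵍ_
infixl 7 _*ᵍ_

_+ᵍ_ : ℤ[i] → ℤ[i] → ℤ[i]
(a + b i) +ᵍ (c + d i) = (a ℤ.+ c) + (b ℤ.+ d) i

-ᵍ_ : ℤ[i] → ℤ[i]
-ᵍ (a + b i) = (ℤ.- a) + (ℤ.- b) i

_-ᵍ_ : ℤ[i] → ℤ[i] → ℤ[i]
x -ᵍ y = x +ᵍ (-ᵍ y)

_*ᵍ_ : ℤ[i] → ℤ[i] → ℤ[i]
(a + b i) *ᵍ (c + d i) = (a ℤ.* c ℤ.- b ℤ.* d) + (a ℤ.* d ℤ.+ b ℤ.* c) i

0ᵍ 1ᵍ iᵍ : ℤ[i]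
0ᵍ = (+ 0) + (+ 0) i
1ᵍ = (+ 1) + (+ 0) i
iᵍ = (+ 0) + (+ 1) i

_²ᵍ : ℤ[i] → ℤ[i]
x ²ᵍ = x *ᵍ x

_⁴ᵍ : ℤ[i] → ℤ[i]
x ⁴ᵍ = (x ²ᵍ) ²ᵍ

_∣ᵍ_ : ℤ[i] → ℤ[i] → Set
d ∣ᵍ a = ∃ λ c → a ≡ d *ᵍ c

IsUnitᵍ : ℤ[i] → Set
IsUnitᵍ u = u ∣ᵍ 1ᵍ

GcdOne₃ : ℤ[i] → ℤ[i] → ℤ[i] → Set
GcdOne₃ x y z = ∀ d → d ∣ᵍ x → d ∣ᵍ y → d ∣ᵍ z → IsUnitᵍ d

-- Both equations reduce to x⁴ = z² + f² y⁴ with f² = ±1. Since (1 + i)⁴ = -4: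
--   x⁴ - y⁴ = i z² gives z⁴ + ((1 + i) x y)⁴ = (i (x⁴ + y⁴))², and
--   x⁴ + y⁴ = i z² gives ((1 + i) x y)⁴ - z⁴ = (x⁴ - y⁴)².
-- For f² = -1 there is no solution with x y ≠ 0, and for f² = 1 none with x y z ≠ 0; in the second
-- case this leaves x⁴ = y⁴, so that y divides x, y and z and is a unit.
--
-- Both are proved by descent. Take x, y coprime, x odd and y = (1 + i) Y (odd means prime to 1 + i).
-- The factors x² ± f y² are coprime and congruent to 1 mod 2, hence squares r² and s². With
-- r = p + q and s = p - q this means p² + q² = x² and p q = i f Y², so p and q are g² and i f h² up to
-- inverse units, with g h = Y. Then g⁴ - f² h⁴ = ± x², where one of g and h is even.

module Submission where

open import Defs
open import Defs using () renaming (_+ᵍ_ to infixl 6 _+_; _*ᵍ_ to infixl 7 _*_; -ᵍ_ to infix 8 -_)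
open import Algebra.Bundles using (CommutativeRing)
import Algebra.Properties.Group as GroupProperties
open import Data.Empty using (⊥; ⊥-elim)
open import Data.Integer as ℤ using (ℤ; +_; -[1+_])
import Data.Integer.DivMod as ℤ
import Data.Integer.Properties as ℤ
open import Data.Integer.Tactic.RingSolver using () renaming (solve-∀ to ℤ-solve-∀)
open import Data.List using ([]; _∷_)
open import Data.Nat as ℕ using (ℕ)
open import Data.Nat.Induction using (<-wellFounded)
import Data.Nat.Properties as ℕ
import Data.Nat.Tactic.RingSolver as ℕ-Solver
open import Data.Product using (_×_; _,_; ∃; ∃₂)
open import Data.Sum using (_⊎_; inj₁; inj₂)
open import Function using (_∘_; _∋_; case_of_)
open import Function.Bundles using (_⇔_; mk⇔)
open import Induction.WellFounded using (Acc; acc)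
open import Relation.Binary.PropositionalEquality
open import Relation.Nullary using (¬_; Dec; yes; no)
open import Relation.Nullary.Decidable using (map′; _×-dec_; dec⇒maybe)
open import Tactic.RingSolver using (solve; solve-∀)
open import Tactic.RingSolver.Core.AlmostCommutativeRing using (AlmostCommutativeRing; fromCommutativeRing)

-- The commutative ring of Gaussian integers.

_≟ᵍ_ : (x y : ℤ[i]) → Dec (x ≡ y)
(a + b i) ≟ᵍ (c + d i) =
  map′ (λ (p , q) → cong₂ _+_i p q) (λ p → cong re p , cong im p) ((a ℤ.≟ c) ×-dec (b ℤ.≟ d))

*ᵍ-comm : ∀ x y → x *ᵍ y ≡ y *ᵍ x
*ᵍ-comm (a + b i) (c + d i) = cong₂ _+_i (l₁ a b c d) (l₂ a b c d)
  where
  l₁ : ∀ a b c d → a ℤ.* c ℤ.- b ℤ.* d ≡ c ℤ.* a ℤ.- d ℤ.* b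
  l₁ = ℤ-solve-∀
  l₂ : ∀ a b c d → a ℤ.* d ℤ.+ b ℤ.* c ≡ c ℤ.* b ℤ.+ d ℤ.* a
  l₂ = ℤ-solve-∀

*ᵍ-assoc : ∀ x y z → (x *ᵍ y) *ᵍ z ≡ x *ᵍ (y *ᵍ z)
*ᵍ-assoc (a + b i) (c + d i) (e + f i) = cong₂ _+_i (l₁ a b c d e f) (l₂ a b c d e f)
  where
  l₁ : ∀ a b c d e f → (a ℤ.* c ℤ.- b ℤ.* d) ℤ.* e ℤ.- (a ℤ.* d ℤ.+ b ℤ.* c) ℤ.* f
                     ≡ a ℤ.* (c ℤ.* e ℤ.- d ℤ.* f) ℤ.- b ℤ.* (c ℤ.* f ℤ.+ d ℤ.* e)
  l₁ = ℤ-solve-∀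
  l₂ : ∀ a b c d e f → (a ℤ.* c ℤ.- b ℤ.* d) ℤ.* f ℤ.+ (a ℤ.* d ℤ.+ b ℤ.* c) ℤ.* e
                     ≡ a ℤ.* (c ℤ.* f ℤ.+ d ℤ.* e) ℤ.+ b ℤ.* (c ℤ.* e ℤ.- d ℤ.* f)
  l₂ = ℤ-solve-∀

*ᵍ-distribˡ : ∀ x y z → x *ᵍ (y +ᵍ z) ≡ x *ᵍ y +ᵍ x *ᵍ z
*ᵍ-distribˡ (a + b i) (c + d i) (e + f i) = cong₂ _+_i (l₁ a b c d e f) (l₂ a b c d e f)
  where
  l₁ : ∀ a b c d e f → a ℤ.* (c ℤ.+ e) ℤ.- b ℤ.* (d ℤ.+ f)
                     ≡ (a ℤ.* c ℤ.- b ℤ.* d) ℤ.+ (a ℤ.* e ℤ.- b ℤ.* f)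
  l₁ = ℤ-solve-∀
  l₂ : ∀ a b c d e f → a ℤ.* (d ℤ.+ f) ℤ.+ b ℤ.* (c ℤ.+ e)
                     ≡ (a ℤ.* d ℤ.+ b ℤ.* c) ℤ.+ (a ℤ.* f ℤ.+ b ℤ.* e)
  l₂ = ℤ-solve-∀

*ᵍ-identityˡ : ∀ x → 1ᵍ *ᵍ x ≡ x
*ᵍ-identityˡ (a + b i) = cong₂ _+_i (l₁ a b) (l₂ a b)
  where
  l₁ : ∀ a b → + 1 ℤ.* a ℤ.- + 0 ℤ.* b ≡ a
  l₁ = ℤ-solve-∀
  l₂ : ∀ a b → + 1 ℤ.* b ℤ.+ + 0 ℤ.* a ≡ b
  l₂ = ℤ-solve-∀

ℤ[i]-commutativeRing : CommutativeRing _ _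
ℤ[i]-commutativeRing = record
  { Carrier = ℤ[i] ; _≈_ = _≡_ ; _+_ = _+ᵍ_ ; _*_ = _*ᵍ_ ; -_ = -_ ; 0# = 0ᵍ ; 1# = 1ᵍ
  ; isCommutativeRing = record
    { isRing = record
      { +-isAbelianGroup = record
        { isGroup = record
          { isMonoid = record
            { isSemigroup = record
              { isMagma = record { isEquivalence = isEquivalence ; ∙-cong = cong₂ _+ᵍ_ }
              ; assoc = λ x y z → cong₂ _+_i (ℤ.+-assoc (re x) (re y) (re z)) (ℤ.+-assoc (im x) (im y) (im z))
              }
            ; identity = (λ x → cong₂ _+_i (ℤ.+-identityˡ (re x)) (ℤ.+-identityˡ (im x)))
                       , (λ x → cong₂ _+_i (ℤ.+-identityʳ (re x)) (ℤ.+-identityʳ (im x)))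
            }
          ; inverse = (λ x → cong₂ _+_i (ℤ.+-inverseˡ (re x)) (ℤ.+-inverseˡ (im x)))
                    , (λ x → cong₂ _+_i (ℤ.+-inverseʳ (re x)) (ℤ.+-inverseʳ (im x)))
          ; ⁻¹-cong = cong -_
          }
        ; comm = λ x y → cong₂ _+_i (ℤ.+-comm (re x) (re y)) (ℤ.+-comm (im x) (im y))
        }
      ; *-cong = cong₂ _*ᵍ_
      ; *-assoc = *ᵍ-assoc
      ; *-identity = *ᵍ-identityˡ , λ x → trans (*ᵍ-comm x 1ᵍ) (*ᵍ-identityˡ x)
      ; distrib = *ᵍ-distribˡ , λ x y z → trans (*ᵍ-comm (y +ᵍ z) x)
          (trans (*ᵍ-distribˡ x y z) (cong₂ _+ᵍ_ (*ᵍ-comm x y) (*ᵍ-comm x z)))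
      }
    ; *-comm = *ᵍ-comm
    }
  }

-- The solver's coefficients are Gaussian integers themselves, so it computes with constants such as
-- `iᵍ` and `π`; the zero test lets it drop terms that cancel.
ring : AlmostCommutativeRing _ _
ring = fromCommutativeRing ℤ[i]-commutativeRing (λ x → dec⇒maybe (0ᵍ ≟ᵍ x))

-- A linear combination step: l - r = k (a - b), with the terms moved so that the solver sees no hypothesis.
linear : ∀ {a b l r} k → a ≡ b → l + k * b ≡ r + k * a → l ≡ r
linear {a} {l = l} {r} k refl = ∙-cancelʳ (k * a) l r
  where open GroupProperties (CommutativeRing.+-group ℤ[i]-commutativeRing)

-- The norm and the absence of zero divisors.

norm : ℤ[i] → ℕ
norm (a + b i) = ℤ.∣ a ∣ ℕ.* ℤ.∣ a ∣ ℕ.+ ℤ.∣ b ∣ ℕ.* ℤ.∣ b ∣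

+∣a∣∣a∣ : ∀ a → + (ℤ.∣ a ∣ ℕ.* ℤ.∣ a ∣) ≡ a ℤ.* a
+∣a∣∣a∣ (+ n) = ℤ.pos-* n n
+∣a∣∣a∣ -[1+ n ] = refl

+norm : ∀ x → + norm x ≡ re x ℤ.* re x ℤ.+ im x ℤ.* im x
+norm (a + b i) = trans (ℤ.pos-+ (ℤ.∣ a ∣ ℕ.* ℤ.∣ a ∣) (ℤ.∣ b ∣ ℕ.* ℤ.∣ b ∣))
  (cong₂ ℤ._+_ (+∣a∣∣a∣ a) (+∣a∣∣a∣ b))

norm-* : ∀ x y → norm (x * y) ≡ norm x ℕ.* norm y
norm-* x@(a + b i) y@(c + d i) = ℤ.+-injective (begin
  + norm (x * y)                              ≡⟨ +norm (x * y) ⟩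
  (a ℤ.* c ℤ.- b ℤ.* d) ℤ.* (a ℤ.* c ℤ.- b ℤ.* d) ℤ.+ (a ℤ.* d ℤ.+ b ℤ.* c) ℤ.* (a ℤ.* d ℤ.+ b ℤ.* c)
                                              ≡⟨ brahmagupta a b c d ⟩
  (a ℤ.* a ℤ.+ b ℤ.* b) ℤ.* (c ℤ.* c ℤ.+ d ℤ.* d) ≡⟨ cong₂ ℤ._*_ (+norm x) (+norm y) ⟨
  + norm x ℤ.* + norm y                       ≡⟨ ℤ.pos-* (norm x) (norm y) ⟨
  + (norm x ℕ.* norm y)                       ∎)
  where
  open ≡-Reasoning
  brahmagupta : ∀ a b c d →
    (a ℤ.* c ℤ.- b ℤ.* d) ℤ.* (a ℤ.* c ℤ.- b ℤ.* d) ℤ.+ (a ℤ.* d ℤ.+ b ℤ.* c) ℤ.* (a ℤ.* d ℤ.+ b ℤ.* c)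
    ≡ (a ℤ.* a ℤ.+ b ℤ.* b) ℤ.* (c ℤ.* c ℤ.+ d ℤ.* d)
  brahmagupta = ℤ-solve-∀

n*n≡0⇒n≡0 : ∀ n → n ℕ.* n ≡ 0 → n ≡ 0
n*n≡0⇒n≡0 n nn≡0 with ℕ.m*n≡0⇒m≡0∨n≡0 n nn≡0
... | inj₁ n≡0 = n≡0
... | inj₂ n≡0 = n≡0

norm≡0⇒≡0 : ∀ x → norm x ≡ 0 → x ≡ 0ᵍ
norm≡0⇒≡0 (a + b i) eq = cong₂ _+_i
  (ℤ.∣i∣≡0⇒i≡0 (n*n≡0⇒n≡0 _ (ℕ.m+n≡0⇒m≡0 _ eq)))
  (ℤ.∣i∣≡0⇒i≡0 (n*n≡0⇒n≡0 _ (ℕ.m+n≡0⇒n≡0 (ℤ.∣ a ∣ ℕ.* ℤ.∣ a ∣) eq)))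

norm>0 : ∀ {x} → x ≢ 0ᵍ → 0 ℕ.< norm x
norm>0 {x} x≢0 = ℕ.n≢0⇒n>0 (x≢0 ∘ norm≡0⇒≡0 x)

*-zero-product : ∀ x y → x * y ≡ 0ᵍ → x ≡ 0ᵍ ⊎ y ≡ 0ᵍ
*-zero-product x y xy≡0 with ℕ.m*n≡0⇒m≡0∨n≡0 (norm x) (trans (sym (norm-* x y)) (cong norm xy≡0))
... | inj₁ p = inj₁ (norm≡0⇒≡0 x p)
... | inj₂ p = inj₂ (norm≡0⇒≡0 y p)

*-≢0 : ∀ {x y} → x ≢ 0ᵍ → y ≢ 0ᵍ → x * y ≢ 0ᵍ
*-≢0 {x} {y} x≢0 y≢0 xy≡0 with *-zero-product x y xy≡0
... | inj₁ x≡0 = x≢0 x≡0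
... | inj₂ y≡0 = y≢0 y≡0

*-cancelˡ : ∀ c x y → c ≢ 0ᵍ → c * x ≡ c * y → x ≡ y
*-cancelˡ c x y c≢0 eq =
  case *-zero-product c (x + - y) (linear 1ᵍ eq (solve (x ∷ y ∷ c ∷ []) ring)) of λ where
    (inj₁ c≡0) → ⊥-elim (c≢0 c≡0)
    (inj₂ x-y≡0) → x ≡ y ∋ linear 1ᵍ x-y≡0 (solve (x ∷ y ∷ []) ring)

*-factorˡ-≢0 : ∀ x y → x * y ≢ 0ᵍ → x ≢ 0ᵍ
*-factorˡ-≢0 x y xy≢0 refl = xy≢0 (zeroˡ y)
  where
  zeroˡ : ∀ y → 0ᵍ * y ≡ 0ᵍ
  zeroˡ = solve-∀ ring

*-factorʳ-≢0 : ∀ x y → x * y ≢ 0ᵍ → y ≢ 0ᵍ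
*-factorʳ-≢0 x y xy≢0 = *-factorˡ-≢0 y x (xy≢0 ∘ trans (*ᵍ-comm x y))

-- Units

IsFourthRoot : ℤ[i] → Set
IsFourthRoot u = (u ≡ 1ᵍ ⊎ u ≡ - 1ᵍ) ⊎ (u ≡ iᵍ ⊎ u ≡ - iᵍ)

∣a∣≡1⇒a≡±1 : ∀ a → ℤ.∣ a ∣ ≡ 1 → a ≡ + 1 ⊎ a ≡ -[1+ 0 ]
∣a∣≡1⇒a≡±1 (+ n) refl = inj₁ refl
∣a∣≡1⇒a≡±1 -[1+ n ] refl = inj₂ refl

norm≡1⇒fourthRoot : ∀ u → norm u ≡ 1 → IsFourthRoot u
norm≡1⇒fourthRoot (a + b i) eq = cases (ℤ.∣ a ∣) (ℤ.∣ b ∣) refl refl eq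
  where
  -- With the absolute values as variables, matching makes `m * m + n * n ≡ 1` compute, which
  -- refutes every pair except (0, 1) and (1, 0).
  cases : ∀ m n → ℤ.∣ a ∣ ≡ m → ℤ.∣ b ∣ ≡ n → m ℕ.* m ℕ.+ n ℕ.* n ≡ 1 → IsFourthRoot (a + b i)
  cases 0 1 ∣a∣≡0 ∣b∣≡1 _ with ℤ.∣i∣≡0⇒i≡0 {a} ∣a∣≡0 | ∣a∣≡1⇒a≡±1 b ∣b∣≡1
  ... | refl | inj₁ refl = inj₂ (inj₁ refl)
  ... | refl | inj₂ refl = inj₂ (inj₂ refl)
  cases 1 0 ∣a∣≡1 ∣b∣≡0 _ with ∣a∣≡1⇒a≡±1 a ∣a∣≡1 | ℤ.∣i∣≡0⇒i≡0 {b} ∣b∣≡0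
  ... | inj₁ refl | refl = inj₁ (inj₁ refl)
  ... | inj₂ refl | refl = inj₁ (inj₂ refl)
  cases 0 0 _ _ ()
  cases 0 (ℕ.suc (ℕ.suc n)) _ _ ()
  cases 1 (ℕ.suc n) _ _ ()
  cases (ℕ.suc (ℕ.suc m)) n _ _ ()

unit⇒fourthRoot : ∀ u v → u * v ≡ 1ᵍ → IsFourthRoot u
unit⇒fourthRoot u v uv≡1 =
  norm≡1⇒fourthRoot u (ℕ.m*n≡1⇒m≡1 (norm u) (norm v) (trans (sym (norm-* u v)) (cong norm uv≡1)))

-- Euclidean division and coprimality

-- Division rounds down; if the remainder exceeds n / 2, the next multiple is the closer one.
nearest-multiple : ∀ m n .{{_ : ℕ.NonZero n}} → ∃ λ q → 2 ℕ.* ℤ.∣ m ℤ.- q ℤ.* + n ∣ ℕ.≤ n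
nearest-multiple m n with 2 ℕ.* (m ℤ.%ℕ n) ℕ.≤? n
... | yes 2r≤n = m ℤ./ℕ n , subst (λ s → 2 ℕ.* ℤ.∣ s ∣ ℕ.≤ n) (sym eq) 2r≤n
  where
  cancel : ∀ r t → r ℤ.+ t ℤ.- t ≡ r
  cancel = ℤ-solve-∀
  eq : m ℤ.- m ℤ./ℕ n ℤ.* + n ≡ + (m ℤ.%ℕ n)
  eq = trans (cong (ℤ._- m ℤ./ℕ n ℤ.* + n) (ℤ.a≡a%ℕn+[a/ℕn]*n m n)) (cancel (+ (m ℤ.%ℕ n)) (m ℤ./ℕ n ℤ.* + n))
... | no 2r≰n = + 1 ℤ.+ m ℤ./ℕ n , (begin
  2 ℕ.* ℤ.∣ m ℤ.- (+ 1 ℤ.+ m ℤ./ℕ n) ℤ.* + n ∣ ≡⟨ cong (λ s → 2 ℕ.* ℤ.∣ s ∣) eq ⟩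
  2 ℕ.* ℤ.∣ r ℤ.⊖ n ∣                          ≡⟨ cong (2 ℕ.*_) (ℤ.∣⊖∣-≤ (ℕ.<⇒≤ (ℤ.n%ℕd<d m n))) ⟩
  2 ℕ.* (n ℕ.∸ r)                              ≡⟨ ℕ.*-distribˡ-∸ 2 n r ⟩
  2 ℕ.* n ℕ.∸ 2 ℕ.* r                          ≤⟨ ℕ.∸-monoʳ-≤ (2 ℕ.* n) (ℕ.<⇒≤ (ℕ.≰⇒> 2r≰n)) ⟩
  2 ℕ.* n ℕ.∸ n                                ≡⟨ ℕ.m+n∸m≡n n (n ℕ.+ 0) ⟩
  n ℕ.+ 0                                      ≡⟨ ℕ.+-identityʳ n ⟩
  n                                            ∎)
  where
  open ℕ.≤-Reasoning
  r = m ℤ.%ℕ n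
  cancel : ∀ r q n → r ℤ.+ q ℤ.* n ℤ.- (+ 1 ℤ.+ q) ℤ.* n ≡ r ℤ.- n
  cancel = ℤ-solve-∀
  eq : m ℤ.- (+ 1 ℤ.+ m ℤ./ℕ n) ℤ.* + n ≡ r ℤ.⊖ n
  eq = trans (cong (ℤ._- (+ 1 ℤ.+ m ℤ./ℕ n) ℤ.* + n) (ℤ.a≡a%ℕn+[a/ℕn]*n m n))
    (trans (cancel (+ r) (m ℤ./ℕ n) (+ n)) (ℤ.m-n≡m⊖n r n))

conj : ℤ[i] → ℤ[i]
conj (a + b i) = a + (ℤ.- b) i

norm-conj : ∀ x → norm (conj x) ≡ norm x
norm-conj (a + b i) = cong (λ n → ℤ.∣ a ∣ ℕ.* ℤ.∣ a ∣ ℕ.+ n ℕ.* n) (ℤ.∣-i∣≡∣i∣ b)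

halves⇒< : ∀ s t n .{{_ : ℕ.NonZero n}} → 2 ℕ.* s ℕ.≤ n → 2 ℕ.* t ℕ.≤ n → s ℕ.* s ℕ.+ t ℕ.* t ℕ.< n ℕ.* n
halves⇒< s t n 2s≤n 2t≤n = ℕ.*-cancelˡ-< 4 _ _ (begin-strict
  4 ℕ.* (s ℕ.* s ℕ.+ t ℕ.* t)                          ≡⟨ expand s t ⟩
  2 ℕ.* s ℕ.* (2 ℕ.* s) ℕ.+ 2 ℕ.* t ℕ.* (2 ℕ.* t)      ≤⟨ ℕ.+-mono-≤ (ℕ.*-mono-≤ 2s≤n 2s≤n) (ℕ.*-mono-≤ 2t≤n 2t≤n) ⟩
  n ℕ.* n ℕ.+ n ℕ.* n                                  <⟨ ℕ.m<m+n (n ℕ.* n ℕ.+ n ℕ.* n) (ℕ.<-≤-trans (ℕ.>-nonZero⁻¹ _ {{ℕ.m*n≢0 n n}}) (ℕ.m≤m+n (n ℕ.* n) (n ℕ.* n))) ⟩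
  n ℕ.* n ℕ.+ n ℕ.* n ℕ.+ (n ℕ.* n ℕ.+ n ℕ.* n)        ≡⟨ collect n ⟩
  4 ℕ.* (n ℕ.* n)                                      ∎)
  where
  open ℕ.≤-Reasoning
  expand : ∀ s t → 4 ℕ.* (s ℕ.* s ℕ.+ t ℕ.* t) ≡ 2 ℕ.* s ℕ.* (2 ℕ.* s) ℕ.+ 2 ℕ.* t ℕ.* (2 ℕ.* t)
  expand = ℕ-Solver.solve-∀
  collect : ∀ n → n ℕ.* n ℕ.+ n ℕ.* n ℕ.+ (n ℕ.* n ℕ.+ n ℕ.* n) ≡ 4 ℕ.* (n ℕ.* n)
  collect = ℕ-Solver.solve-∀

-- The quotient rounds both coordinates of x conj(y) / N(y) to nearest integers. The bound is proved
-- after multiplication by N(conj y) = N(y), where both coordinates of r conj(y) are at most N(y) /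
-- 2 in absolute value.
division : ∀ x y → y ≢ 0ᵍ → ∃₂ λ q r → x ≡ y * q + r × norm r ℕ.< norm y
division x@(a + b i) y@(c + d i) y≢0 = quotient
  (nearest-multiple (a ℤ.* c ℤ.+ b ℤ.* d) (norm y)) (nearest-multiple (b ℤ.* c ℤ.- a ℤ.* d) (norm y))
  where
  instance
    norm≢0 : ℕ.NonZero (norm y)
    norm≢0 = ℕ.>-nonZero (norm>0 y≢0)
  n = norm y
  quotient : (∃ λ s → 2 ℕ.* ℤ.∣ (a ℤ.* c ℤ.+ b ℤ.* d) ℤ.- s ℤ.* + norm y ∣ ℕ.≤ norm y) →
             (∃ λ t → 2 ℕ.* ℤ.∣ (b ℤ.* c ℤ.- a ℤ.* d) ℤ.- t ℤ.* + norm y ∣ ℕ.≤ norm y) →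
             ∃₂ λ q r → x ≡ y * q + r × norm r ℕ.< norm y
  quotient (s , s-near) (t , t-near) = q , r , x≡ x (y * q) , ℕ.*-cancelʳ-< (norm y) (norm r) (norm y) (begin-strict
    norm r ℕ.* norm y          ≡⟨ cong (norm r ℕ.*_) (norm-conj y) ⟨
    norm r ℕ.* norm (conj y)   ≡⟨ norm-* r (conj y) ⟨
    norm (r * conj y)          ≡⟨ cong norm r*conj ⟩
    norm (((a ℤ.* c ℤ.+ b ℤ.* d) ℤ.- s ℤ.* + n) + ((b ℤ.* c ℤ.- a ℤ.* d) ℤ.- t ℤ.* + n) i)
                               <⟨ halves⇒< ℤ.∣ (a ℤ.* c ℤ.+ b ℤ.* d) ℤ.- s ℤ.* + n ∣ ℤ.∣ (b ℤ.* c ℤ.- a ℤ.* d) ℤ.- t ℤ.* + n ∣ n s-near t-near ⟩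
    norm y ℕ.* norm y          ∎)
    where
    open ℕ.≤-Reasoning
    q r : ℤ[i]
    q = s + t i
    r = x + - (y * q)
    x≡ : ∀ x z → x ≡ z + (x + - z)
    x≡ = solve-∀ ring
    re-part : ∀ a b c d s t →
      (a ℤ.+ ℤ.- (c ℤ.* s ℤ.- d ℤ.* t)) ℤ.* c ℤ.- (b ℤ.+ ℤ.- (c ℤ.* t ℤ.+ d ℤ.* s)) ℤ.* (ℤ.- d)
      ≡ (a ℤ.* c ℤ.+ b ℤ.* d) ℤ.- s ℤ.* (c ℤ.* c ℤ.+ d ℤ.* d)
    re-part = ℤ-solve-∀
    im-part : ∀ a b c d s t →
      (a ℤ.+ ℤ.- (c ℤ.* s ℤ.- d ℤ.* t)) ℤ.* (ℤ.- d) ℤ.+ (b ℤ.+ ℤ.- (c ℤ.* t ℤ.+ d ℤ.* s)) ℤ.* c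
      ≡ (b ℤ.* c ℤ.- a ℤ.* d) ℤ.- t ℤ.* (c ℤ.* c ℤ.+ d ℤ.* d)
    im-part = ℤ-solve-∀
    r*conj : r * conj y ≡ ((a ℤ.* c ℤ.+ b ℤ.* d) ℤ.- s ℤ.* + n) + ((b ℤ.* c ℤ.- a ℤ.* d) ℤ.- t ℤ.* + n) i
    r*conj = cong₂ _+_i
      (trans (re-part a b c d s t) (cong (λ m → (a ℤ.* c ℤ.+ b ℤ.* d) ℤ.- s ℤ.* m) (sym (+norm y))))
      (trans (im-part a b c d s t) (cong (λ m → (b ℤ.* c ℤ.- a ℤ.* d) ℤ.- t ℤ.* m) (sym (+norm y))))

record Bézout (x y : ℤ[i]) : Set where
  constructor bézout
  field
    g u v x′ y′ : ℤ[i]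
    x≡ : x ≡ g * x′
    y≡ : y ≡ g * y′
    g≡ : g ≡ u * x + v * y

euclid : ∀ x y → Acc ℕ._<_ (norm y) → Bézout x y
euclid x y (acc rec) with y ≟ᵍ 0ᵍ
... | yes refl = bézout x 1ᵍ 0ᵍ 1ᵍ 0ᵍ (solve (x ∷ []) ring) (solve (x ∷ []) ring) (solve (x ∷ []) ring)
... | no y≢0 =
  case division x y y≢0 of λ { (q , r , x≡yq+r , r<y) →
  case euclid y r (rec r<y) of λ { (bézout g u v y′ r′ y≡ r≡ g≡) →
  let x≡ : x ≡ g * (y′ * q + r′)
      x≡ = linear 1ᵍ x≡yq+r (linear q y≡ (linear 1ᵍ r≡ (solve (x ∷ y ∷ r ∷ g ∷ y′ ∷ q ∷ r′ ∷ []) ring)))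
      g≡′ : g ≡ v * x + (u + - (v * q)) * y
      g≡′ = linear 1ᵍ g≡ (linear (- v) x≡yq+r (solve (g ∷ x ∷ y ∷ q ∷ r ∷ u ∷ v ∷ []) ring))
  in bézout g v (u + - (v * q)) (y′ * q + r′) y′ x≡ y≡ g≡′ } }

-- Encoded as a Bézout identity, so that the closure properties below become polynomial identities.
Coprime : ℤ[i] → ℤ[i] → Set
Coprime x y = ∃₂ λ u v → u * x + v * y ≡ 1ᵍ

coprime-sym : ∀ {x y} → Coprime x y → Coprime y x
coprime-sym {x} {y} (u , v , eq) = v , u , linear 1ᵍ eq (solve (u ∷ v ∷ x ∷ y ∷ []) ring)

-- The witnesses come from multiplying the two Bézout identities.
coprime-*ʳ : ∀ {x y z} → Coprime x y → Coprime x z → Coprime x (y * z)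
coprime-*ʳ {x} {y} {z} (u , v , eq) (u′ , v′ , eq′) =
  u * u′ * x + u * v′ * z + v * y * u′ , v * v′ ,
  linear (u′ * x + v′ * z) eq (linear 1ᵍ eq′ (solve (u ∷ v ∷ u′ ∷ v′ ∷ x ∷ y ∷ z ∷ []) ring))

coprime-factorˡ : ∀ {x} y z → Coprime x (y * z) → Coprime x y
coprime-factorˡ {x} y z (u , v , eq) = u , v * z , linear 1ᵍ eq (solve (u ∷ v ∷ x ∷ y ∷ z ∷ []) ring)

coprime-factorʳ : ∀ {x} y z → Coprime x (y * z) → Coprime x z
coprime-factorʳ y z = coprime-factorˡ z y ∘ subst (Coprime _) (*ᵍ-comm y z)

coprime-shift : ∀ {x y z} k → Coprime x y → z ≡ y + k * x → Coprime x z
coprime-shift {x} {y} k (u , v , eq) refl =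
  u + - (v * k) , v , linear 1ᵍ eq (solve (u ∷ v ∷ x ∷ y ∷ k ∷ []) ring)

coprime-unit : ∀ {x} u v → u * v ≡ 1ᵍ → Coprime x u
coprime-unit {x} u v uv≡1 = 0ᵍ , v , linear 1ᵍ uv≡1 (solve (x ∷ u ∷ v ∷ []) ring)

coprime-sqrt : ∀ {x y} → Coprime (x * x) (y * y) → Coprime x y
coprime-sqrt {x} {y} c = coprime-factorˡ y y (coprime-sym (coprime-factorˡ x x (coprime-sym c)))

-- Euclid's lemma: multiply u x + v y = 1 by w and replace y w by x z.
coprime-∣ : ∀ {x y z w} → Coprime x y → x * z ≡ y * w → ∃ λ k → w ≡ x * k
coprime-∣ {x} {y} {z} {w} (u , v , eq) xz≡yw = u * w + v * z ,
  linear (- v) xz≡yw (linear w (sym eq) (solve (u ∷ v ∷ x ∷ y ∷ z ∷ w ∷ []) ring))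

-- Cancelling the gcd from g = u x + v y leaves a Bézout identity for the cofactors.
coprime-parts : ∀ x y → x ≢ 0ᵍ → ∃ λ g → ∃₂ λ x′ y′ → x ≡ g * x′ × y ≡ g * y′ × g ≢ 0ᵍ × Coprime x′ y′
coprime-parts x y x≢0 = case euclid x y (<-wellFounded (norm y)) of λ { (bézout g u v x′ y′ x≡ y≡ g≡) →
  let g≢0 = *-factorˡ-≢0 g x′ (x≢0 ∘ trans x≡)
      bézout-identity : u * x′ + v * y′ ≡ 1ᵍ
      bézout-identity = *-cancelˡ g (u * x′ + v * y′) 1ᵍ g≢0 (linear (- 1ᵍ) g≡ (linear (- u) x≡ (linear (- v) y≡
        (solve (g ∷ u ∷ v ∷ x ∷ y ∷ x′ ∷ y′ ∷ []) ring))))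
  in g , x′ , y′ , x≡ , y≡ , g≢0 , u , v , bézout-identity }

-- Once the gcd of d and z is cancelled, d′ is prime to z′² and divides it, so d′ divides 1.
square-∣⇒∣ : ∀ d m z → d ≢ 0ᵍ → d * d * m ≡ z * z → ∃ λ c → z ≡ d * c
square-∣⇒∣ d m z d≢0 eq = case coprime-parts d z d≢0 of λ { (h , d′ , z′ , refl , refl , h≢0 , cop) →
  let d′d′m≡z′z′ : d′ * (m * d′) ≡ z′ * z′ * 1ᵍ
      d′d′m≡z′z′ = *-cancelˡ (h * h) (d′ * (m * d′)) (z′ * z′ * 1ᵍ) (*-≢0 h≢0 h≢0) (linear 1ᵍ eq (solve (h ∷ d′ ∷ z′ ∷ m ∷ []) ring)) in
  case coprime-∣ {d′} {z′ * z′} {m * d′} {1ᵍ} (coprime-*ʳ cop cop) d′d′m≡z′z′ of λ { (k , 1≡d′k) →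
    k * z′ , (h * z′ ≡ h * d′ * (k * z′) ∋ linear (h * z′) 1≡d′k (solve (h ∷ z′ ∷ d′ ∷ k ∷ []) ring)) } }

-- Coprime factors of c² are squares up to mutually inverse units. The field `gh≡c` later makes the
-- descent decrease.
record Split (a b c : ℤ[i]) : Set where
  constructor split
  field
    u v g h : ℤ[i]
    uv≡1 : u * v ≡ 1ᵍ
    a≡ugg : a ≡ u * (g * g)
    b≡vhh : b ≡ v * (h * h)
    gh≡c : g * h ≡ c

-- With g = gcd(a, c), the cofactor of g in a and g itself divide each other.
square-split : ∀ a b c → c ≢ 0ᵍ → Coprime a b → a * b ≡ c * c → Split a b c
square-split a b c c≢0 cop ab≡cc =
  case coprime-parts a c (*-factorˡ-≢0 a b (*-≢0 c≢0 c≢0 ∘ trans (sym ab≡cc))) of λ { (g , a′ , h , a≡ , c≡ , g≢0 , cop′) →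
  let a′b≡hhg : a′ * b ≡ h * h * g
      a′b≡hhg = *-cancelˡ g (a′ * b) (h * h * g) g≢0
        (linear 1ᵍ ab≡cc (linear (- b) a≡ (linear (c + g * h) c≡ (solve (a ∷ b ∷ c ∷ g ∷ a′ ∷ h ∷ []) ring))))
      cop″ : Coprime g b
      cop″ = coprime-sym (coprime-factorˡ g a′ (subst (Coprime b) a≡ (coprime-sym cop)))
      ghh≡ba′ : g * (h * h) ≡ b * a′
      ghh≡ba′ = linear (- 1ᵍ) a′b≡hhg (solve (g ∷ a′ ∷ b ∷ h ∷ []) ring) in
  case coprime-∣ {a′} {h * h} {b} {g} (coprime-*ʳ cop′ cop′) a′b≡hhg of λ { (v , g≡a′v) →
  case coprime-∣ {g} {b} {h * h} {a′} cop″ ghh≡ba′ of λ { (u , a′≡gu) →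
  let uv≡1 : u * v ≡ 1ᵍ
      uv≡1 = *-cancelˡ g (u * v) 1ᵍ g≢0 (linear (- v) a′≡gu (linear (- 1ᵍ) g≡a′v (solve (g ∷ u ∷ v ∷ a′ ∷ []) ring)))
      a≡ugg : a ≡ u * (g * g)
      a≡ugg = linear 1ᵍ a≡ (linear g a′≡gu (solve (a ∷ g ∷ u ∷ a′ ∷ []) ring))
      b≡vhh : b ≡ v * (h * h)
      b≡vhh = *-cancelˡ g b (v * (h * h)) g≢0 (linear v a′b≡hhg (linear b g≡a′v (solve (g ∷ b ∷ v ∷ h ∷ a′ ∷ []) ring)))
  in split u v g h uv≡1 a≡ugg b≡vhh (sym c≡) } } }

-- Parity

π 2ᵍ : ℤ[i]
π = 1ᵍ + iᵍ
2ᵍ = 1ᵍ + 1ᵍ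

-- Parity is taken modulo the prime 1 + i, whose residue field has two elements. Since π² = 2 i, the
-- number 2 equals -i π²; this is the origin of the factors `- iᵍ * π` in the witnesses.
Even Odd : ℤ[i] → Set
Even x = ∃ λ c → x ≡ π * c
Odd x = ∃ λ c → x ≡ 1ᵍ + π * c

ℤ-even-or-odd : ∀ n → ∃ λ k → n ≡ k ℤ.+ k ⊎ n ≡ + 1 ℤ.+ (k ℤ.+ k)
ℤ-even-or-odd n with n ℤ.%ℕ 2 | n ℤ./ℕ 2 | ℤ.n%ℕd<d n 2 | ℤ.a≡a%ℕn+[a/ℕn]*n n 2
... | 0 | k | _ | refl = k , inj₁ (lemma k)
  where
  lemma : ∀ k → + 0 ℤ.+ k ℤ.* + 2 ≡ k ℤ.+ k
  lemma = ℤ-solve-∀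
... | 1 | k | _ | refl = k , inj₂ (lemma k)
  where
  lemma : ∀ k → + 1 ℤ.+ k ℤ.* + 2 ≡ + 1 ℤ.+ (k ℤ.+ k)
  lemma = ℤ-solve-∀
... | ℕ.suc (ℕ.suc _) | _ | ℕ.s≤s (ℕ.s≤s ()) | _

-- a + b i = (a - b) + π b and 2 = π (1 - i).
even-or-odd : ∀ x → Even x ⊎ Odd x
even-or-odd (a + b i) = case ℤ-even-or-odd (a ℤ.- b) of λ where
    (k , inj₁ a-b≡k+k) → inj₁ ((b ℤ.+ k) + (ℤ.- k) i ,
      cong₂ _+_i (trans (re₀ a b) (trans (cong (ℤ._+ b) a-b≡k+k) (re₁ b k))) (im₁ b k))
    (k , inj₂ a-b≡1+k+k) → inj₂ ((b ℤ.+ k) + (ℤ.- k) i ,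
      cong₂ _+_i (trans (re₀ a b) (trans (cong (ℤ._+ b) a-b≡1+k+k) (re₂ b k))) (im₂ b k))
  where
  re₀ : ∀ a b → a ≡ a ℤ.- b ℤ.+ b
  re₀ = ℤ-solve-∀
  re₁ : ∀ b k → k ℤ.+ k ℤ.+ b ≡ + 1 ℤ.* (b ℤ.+ k) ℤ.- + 1 ℤ.* (ℤ.- k)
  re₁ = ℤ-solve-∀
  im₁ : ∀ b k → b ≡ + 1 ℤ.* (ℤ.- k) ℤ.+ + 1 ℤ.* (b ℤ.+ k)
  im₁ = ℤ-solve-∀
  re₂ : ∀ b k → + 1 ℤ.+ (k ℤ.+ k) ℤ.+ b ≡ + 1 ℤ.+ (+ 1 ℤ.* (b ℤ.+ k) ℤ.- + 1 ℤ.* (ℤ.- k))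
  re₂ = ℤ-solve-∀
  im₂ : ∀ b k → b ≡ + 0 ℤ.+ (+ 1 ℤ.* (ℤ.- k) ℤ.+ + 1 ℤ.* (b ℤ.+ k))
  im₂ = ℤ-solve-∀

π-not-unit : ∀ c → π * c ≢ 1ᵍ
π-not-unit c πc≡1 = case ℕ.m*n≡1⇒m≡1 2 (norm c) (trans (sym (norm-* π c)) (cong norm πc≡1)) of λ ()

even⇒¬odd : ∀ {x} → Even x → ¬ Odd x
even⇒¬odd {x} (c , x≡πc) (d , x≡1+πd) =
  π-not-unit (c + - d) (linear 1ᵍ x≡1+πd (linear (- 1ᵍ) x≡πc (solve (x ∷ c ∷ d ∷ []) ring)))

odd-* : ∀ {x y} → Odd x → Odd y → Odd (x * y)
odd-* {x} {y} (c , x≡) (d , y≡) =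
  c + d + π * c * d , linear y x≡ (linear (1ᵍ + π * c) y≡ (solve (x ∷ y ∷ c ∷ d ∷ []) ring))

even-*ˡ : ∀ {x} y → Even x → Even (x * y)
even-*ˡ {x} y (c , x≡) = c * y , linear y x≡ (solve (x ∷ y ∷ c ∷ []) ring)

even-sqrt : ∀ x → Even (x * x) → Even x
even-sqrt x even-xx = case even-or-odd x of λ where
  (inj₁ even-x) → even-x
  (inj₂ odd-x) → ⊥-elim (even⇒¬odd even-xx (odd-* odd-x odd-x))

odd-sqrt : ∀ x → Odd (x * x) → Odd x
odd-sqrt x odd-xx = case even-or-odd x of λ where
  (inj₁ even-x) → ⊥-elim (even⇒¬odd (even-*ˡ x even-x) odd-xx)
  (inj₂ odd-x) → odd-x

-- Because π² = 2 i, squaring 1 + π c improves the congruence from modulo π to modulo 2.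
odd-square : ∀ {x} → Odd x → ∃ λ k → x * x ≡ 1ᵍ + 2ᵍ * k
odd-square {x} (c , x≡) =
  π * c + iᵍ * (c * c) , linear (x + (1ᵍ + π * c)) x≡ (solve (x ∷ c ∷ []) ring)

≡1[2]⇒odd : ∀ {x} k → x ≡ 1ᵍ + 2ᵍ * k → Odd x
≡1[2]⇒odd {x} k x≡ = - iᵍ * π * k , linear 1ᵍ x≡ (solve (x ∷ k ∷ []) ring)

odd≢0 : ∀ {x} → Odd x → x ≢ 0ᵍ
odd≢0 odd-x refl = even⇒¬odd (0ᵍ , refl) odd-x

-- Although i is 1 modulo π, the difference i - 1 = i π is not divisible by π², that is, by 2.
i≢1[2] : ∀ m n → iᵍ * (1ᵍ + 2ᵍ * m) ≢ 1ᵍ + 2ᵍ * n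
i≢1[2] m n eq = π-not-unit (iᵍ * m + - n) (*-cancelˡ π (π * (iᵍ * m + - n)) 1ᵍ (λ ()) 
  (linear iᵍ eq (solve (m ∷ n ∷ []) ring)))

coprime⇒¬even : ∀ {x y} → Coprime x y → Even x → ¬ Even y
coprime⇒¬even {x} {y} (u , v , eq) (c , x≡) (d , y≡) =
  π-not-unit (u * c + v * d)
    (linear 1ᵍ eq (linear (- u) x≡ (linear (- v) y≡ (solve (x ∷ y ∷ u ∷ v ∷ c ∷ d ∷ []) ring))))

record SquareRoots (a b : ℤ[i]) : Set where
  constructor squareRoots
  field
    r s : ℤ[i]
    a≡rr : a ≡ r * r
    b≡ss : b ≡ s * s

-- Of the possible units in a = u g², ±1 are squares and can be absorbed into g and h. As g is odd,
-- g² is 1 modulo 2, so u = ±i would contradict a being 1 modulo 2.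
≡1[2]⇒squares : ∀ k a b c → c ≢ 0ᵍ → Coprime a b → a * b ≡ c * c → a ≡ 1ᵍ + 2ᵍ * k → SquareRoots a b
≡1[2]⇒squares k a b c c≢0 cop ab≡cc a≡1+2k =
  case square-split a b c c≢0 cop ab≡cc of λ { (split u v g h uv≡1 a≡ugg b≡vhh _) →
  let odd-g : Odd g
      odd-g = case even-or-odd g of λ where
        (inj₂ odd) → odd
        (inj₁ (d , g≡)) → ⊥-elim (even⇒¬odd {a}
          (u * g * d , linear 1ᵍ a≡ugg (linear (u * g) g≡ (solve (a ∷ u ∷ g ∷ d ∷ []) ring)))
          (≡1[2]⇒odd k a≡1+2k)) in
  case odd-square odd-g of λ { (m , gg≡1+2m) →
  case unit⇒fourthRoot u v uv≡1 of λ where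
    (inj₁ (inj₁ u≡1)) → squareRoots g h
      (a ≡ g * g ∋ linear 1ᵍ a≡ugg (linear (g * g) u≡1 (solve (a ∷ u ∷ g ∷ []) ring)))
      (b ≡ h * h ∋ linear 1ᵍ b≡vhh (linear (- (v * (h * h))) u≡1 (linear (h * h) uv≡1 (solve (b ∷ u ∷ v ∷ h ∷ []) ring))))
    (inj₁ (inj₂ u≡-1)) → squareRoots (iᵍ * g) (iᵍ * h)
      (a ≡ iᵍ * g * (iᵍ * g) ∋ linear 1ᵍ a≡ugg (linear (g * g) u≡-1 (solve (a ∷ u ∷ g ∷ []) ring)))
      (b ≡ iᵍ * h * (iᵍ * h) ∋ linear 1ᵍ b≡vhh (linear (v * (h * h)) u≡-1 (linear (- (h * h)) uv≡1 (solve (b ∷ u ∷ v ∷ h ∷ []) ring))))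
    (inj₂ (inj₁ u≡i)) → ⊥-elim (i≢1[2] m k
      (linear (- iᵍ) gg≡1+2m (linear (- 1ᵍ) a≡ugg (linear 1ᵍ a≡1+2k (linear (- (g * g)) u≡i
        (solve (a ∷ u ∷ g ∷ m ∷ k ∷ []) ring))))))
    -- Here -i (1 + 2 m) = i (1 + 2 (-1 - m)).
    (inj₂ (inj₂ u≡-i)) → ⊥-elim (i≢1[2] (- 1ᵍ + - m) k
      (linear iᵍ gg≡1+2m (linear (- 1ᵍ) a≡ugg (linear 1ᵍ a≡1+2k (linear (- (g * g)) u≡-i
        (solve (a ∷ u ∷ g ∷ m ∷ k ∷ []) ring)))))) } }

-- For d = r - s the hypothesis reads d² = 4 m - 2 s d. Hence π divides d, and with d = π t it also
-- divides t, so that d = π² q = 2 i q.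
even-difference : ∀ r s m → r * r ≡ s * s + 2ᵍ * 2ᵍ * m → ∃ λ q → r ≡ s + 2ᵍ * q
even-difference r s m rr≡ = case even-or-odd (r + - s) of λ where
  (inj₂ (t , r-s≡)) → ⊥-elim (even⇒¬odd {(r + - s) * (r + - s)}
    (- (iᵍ * π * (2ᵍ * m + - (s * (r + - s)))) , linear 1ᵍ rr≡ (solve (r ∷ s ∷ m ∷ []) ring))
    (odd-* (t , r-s≡) (t , r-s≡)))
  (inj₁ (t , r-s≡)) → case even-or-odd t of λ where
    (inj₁ (q , t≡)) → iᵍ * q ,
      (r ≡ s + 2ᵍ * (iᵍ * q) ∋ linear 1ᵍ r-s≡ (linear π t≡ (solve (r ∷ s ∷ t ∷ q ∷ []) ring)))
    (inj₂ odd-t) → let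
      tt≡ : t * t ≡ π * (iᵍ * s * t + - (π * m))
      tt≡ = *-cancelˡ (2ᵍ * iᵍ) (t * t) (π * (iᵍ * s * t + - (π * m))) (λ ())
        (linear 1ᵍ rr≡ (linear (- (r + s + π * t)) r-s≡ (solve (r ∷ s ∷ m ∷ t ∷ []) ring)))
      in ⊥-elim (even⇒¬odd (iᵍ * s * t + - (π * m) , tt≡) (odd-* odd-t odd-t))

-- The second number is S - 2 f y², where S is the first. S is prime to 2 as it is 1 modulo 2, to f
-- as f is a unit, and to y as it is x² modulo y.
coprime-x²±fy² : ∀ f f′ x y k → f * f′ ≡ 1ᵍ → Coprime x y → x * x + f * (y * y) ≡ 1ᵍ + 2ᵍ * k →
  Coprime (x * x + f * (y * y)) (x * x + - (f * (y * y)))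
coprime-x²±fy² f f′ x y k ff′≡1 cop S≡1+2k =
  coprime-shift {x * x + f * (y * y)} { - 2ᵍ * f * (y * y)} {x * x + - (f * (y * y))} 1ᵍ
    (coprime-*ʳ {y = - 2ᵍ * f} {y * y} (coprime-*ʳ {y = - 2ᵍ} {f} cop-2 (coprime-unit f f′ ff′≡1))
      (coprime-*ʳ {y = y} {y} cop-y cop-y))
    (solve (f ∷ x ∷ y ∷ []) ring)
  where
  cop-2 : Coprime (x * x + f * (y * y)) (- 2ᵍ)
  cop-2 = 1ᵍ , k , linear 1ᵍ S≡1+2k (solve (f ∷ x ∷ y ∷ k ∷ []) ring)
  cop-y : Coprime (x * x + f * (y * y)) y
  cop-y = coprime-sym (coprime-shift {y} {x * x} {x * x + f * (y * y)} (f * y) (coprime-*ʳ {y} {x} {x} (coprime-sym cop) (coprime-sym cop)) (solve (f ∷ x ∷ y ∷ []) ring))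

-- Descent

record Pythagorean (f x Y : ℤ[i]) : Set where
  constructor pythagorean
  field
    p q : ℤ[i]
    cop : Coprime p q
    pq≡ : p * q ≡ iᵍ * f * (Y * Y)
    sum≡ : p * p + q * q ≡ x * x

-- Subtracting the equations gives r² - s² = 4 i f Y², so r = s + 2 q. With p = s + q one has r² -
-- s² = 4 p q and r² + s² = 2 (p² + q²).
roots⇒pythagorean : ∀ f x Y r s →
  x * x + f * (π * Y * (π * Y)) ≡ r * r → x * x + - (f * (π * Y * (π * Y))) ≡ s * s →
  Coprime r s → Pythagorean f x Y
roots⇒pythagorean f x Y r s S≡rr T≡ss cop-rs =
  let rr≡ : r * r ≡ s * s + 2ᵍ * 2ᵍ * (iᵍ * f * (Y * Y))
      rr≡ = linear (- 1ᵍ) S≡rr (linear 1ᵍ T≡ss (solve (f ∷ x ∷ Y ∷ r ∷ s ∷ []) ring))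
  in case even-difference r s (iᵍ * f * (Y * Y)) rr≡ of λ { (q , r≡s+2q) →
  let cop-sq : Coprime s q
      cop-sq = coprime-factorʳ 2ᵍ q (coprime-shift {s} {r} {2ᵍ * q} (- 1ᵍ) (coprime-sym cop-rs)
        (linear (- 1ᵍ) r≡s+2q (solve (r ∷ s ∷ q ∷ []) ring)))
      cop-pq : Coprime (s + q) q
      cop-pq = coprime-sym (coprime-shift {q} {s} {s + q} 1ᵍ (coprime-sym cop-sq) (solve (s ∷ q ∷ []) ring))
      pq≡ : (s + q) * q ≡ iᵍ * f * (Y * Y)
      pq≡ = *-cancelˡ (2ᵍ * 2ᵍ) ((s + q) * q) (iᵍ * f * (Y * Y)) (λ ())
        (linear 1ᵍ rr≡ (linear (- (r + s + 2ᵍ * q)) r≡s+2q (solve (f ∷ Y ∷ r ∷ s ∷ q ∷ []) ring)))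
      sum≡ : (s + q) * (s + q) + q * q ≡ x * x
      sum≡ = *-cancelˡ 2ᵍ ((s + q) * (s + q) + q * q) (x * x) (λ ())
        (linear (- 1ᵍ) S≡rr (linear (- 1ᵍ) T≡ss (linear (- (r + s + 2ᵍ * q)) r≡s+2q
          (solve (f ∷ x ∷ Y ∷ r ∷ s ∷ q ∷ []) ring))))
  in pythagorean (s + q) q cop-pq pq≡ sum≡ }

-- The original equation for two factors of `Y`, which of them is even being left open; oddness of
-- `w` will rule out that both are odd.
record Smaller (f Y : ℤ[i]) : Set where
  constructor smaller
  field
    g h w : ℤ[i]
    gh≡Y : g * h ≡ Y
    cop : Coprime g h
    odd-w : Odd w
    eq : g * g * (g * g) ≡ w * w + f * f * (h * h * (h * h))

fourthRoot-square : ∀ {u} → IsFourthRoot u → u * u ≡ 1ᵍ ⊎ u * u ≡ - 1ᵍ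
fourthRoot-square (inj₁ (inj₁ refl)) = inj₁ refl
fourthRoot-square (inj₁ (inj₂ refl)) = inj₁ refl
fourthRoot-square (inj₂ (inj₁ refl)) = inj₂ refl
fourthRoot-square (inj₂ (inj₂ refl)) = inj₂ refl

odd-i* : ∀ {x} → Odd x → Odd (iᵍ * x)
odd-i* (c , x≡) = odd-* {iᵍ} (iᵍ , refl) (c , x≡)

-- With p = u g² and q = i f v h², the sum p² + q² is u² (g⁴ - f² h⁴), because u² = ±1 makes v² =
-- u². So g⁴ - f² h⁴ is x² or -x² = (i x)².
pythagorean⇒smaller : ∀ f x Y → f * f * (f * f) ≡ 1ᵍ → Y ≢ 0ᵍ → Odd x → Pythagorean f x Y → Smaller f Y
pythagorean⇒smaller f x Y f⁴≡1 Y≢0 odd-x (pythagorean p q cop-pq pq≡ sum≡) =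
  -- Since f⁴ = 1, -i f³ is inverse to i f; scaling q by it turns p q = i f Y² into a product equal
  -- to Y².
  case square-split p (- iᵍ * (f * f * f) * q) Y Y≢0 cop-pb pb≡YY of λ { (split u v g h uv≡1 p≡ugg b≡vhh gh≡Y) →
  let q≡ : q ≡ iᵍ * f * (v * (h * h))
      q≡ = linear (iᵍ * f) b≡vhh (linear (- q) f⁴≡1 (solve (f ∷ q ∷ v ∷ h ∷ []) ring))
      cop₁ : Coprime (v * (h * h)) (u * (g * g))
      cop₁ = subst₂ Coprime b≡vhh p≡ugg (coprime-sym cop-pb)
      cop₂ : Coprime (g * g) (h * h)
      cop₂ = coprime-factorʳ v (h * h) (coprime-sym (coprime-factorʳ u (g * g) cop₁))
  in
  case fourthRoot-square (unit⇒fourthRoot u v uv≡1) of λ where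
    (inj₁ uu≡1) → smaller g h x gh≡Y (coprime-sqrt cop₂) odd-x
      (g * g * (g * g) ≡ x * x + f * f * (h * h * (h * h)) ∋ linear 1ᵍ sum≡ (linear (- (p + u * (g * g))) p≡ugg (linear (- (q + iᵍ * f * (v * (h * h)))) q≡
        (linear (- (g * g * (g * g)) + - (f * f * (h * h * (h * h)) * (v * v))) uu≡1
        (linear (f * f * (h * h * (h * h)) * (u * v + 1ᵍ)) uv≡1
        (solve (f ∷ x ∷ p ∷ q ∷ u ∷ v ∷ g ∷ h ∷ []) ring))))))
    (inj₂ uu≡-1) → smaller g h (iᵍ * x) gh≡Y (coprime-sqrt cop₂) (odd-i* odd-x)
      (g * g * (g * g) ≡ iᵍ * x * (iᵍ * x) + f * f * (h * h * (h * h)) ∋ linear (- 1ᵍ) sum≡ (linear (p + u * (g * g)) p≡ugg (linear (q + iᵍ * f * (v * (h * h))) q≡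
        (linear (g * g * (g * g) + - (f * f * (h * h * (h * h)) * (v * v))) uu≡-1
        (linear (f * f * (h * h * (h * h)) * (u * v + 1ᵍ)) uv≡1
        (solve (f ∷ x ∷ p ∷ q ∷ u ∷ v ∷ g ∷ h ∷ []) ring)))))) }
  where
  cop-pb : Coprime p (- iᵍ * (f * f * f) * q)
  cop-pb = coprime-*ʳ {p} { - iᵍ * (f * f * f)} {q}
    (coprime-unit (- iᵍ * (f * f * f)) (iᵍ * f) (linear 1ᵍ f⁴≡1 (solve (f ∷ []) ring))) cop-pq
  pb≡YY : p * (- iᵍ * (f * f * f) * q) ≡ Y * Y
  pb≡YY = linear (- iᵍ * (f * f * f)) pq≡ (linear (Y * Y) f⁴≡1 (solve (f ∷ p ∷ q ∷ Y ∷ []) ring))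

descent-step : ∀ f x Y z → f * f * (f * f) ≡ 1ᵍ → Odd x → Y ≢ 0ᵍ → Coprime x (π * Y) →
  x * x * (x * x) ≡ z * z + f * f * (π * Y * (π * Y) * (π * Y * (π * Y))) → Smaller f Y
descent-step f x Y z f⁴≡1 odd-x Y≢0 cop eq = case odd-square odd-x of λ { (k , xx≡1+2k) →
  let S≡1+2m : x * x + f * (π * Y * (π * Y)) ≡ 1ᵍ + 2ᵍ * (k + iᵍ * f * (Y * Y))
      S≡1+2m = linear 1ᵍ xx≡1+2k (solve (f ∷ x ∷ Y ∷ k ∷ []) ring)
      T≡1+2n : x * x + - (f * (π * Y * (π * Y))) ≡ 1ᵍ + 2ᵍ * (k + - (iᵍ * f * (Y * Y)))
      T≡1+2n = linear 1ᵍ xx≡1+2k (solve (f ∷ x ∷ Y ∷ k ∷ []) ring)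
      ST≡zz : (x * x + f * (π * Y * (π * Y))) * (x * x + - (f * (π * Y * (π * Y)))) ≡ z * z
      ST≡zz = linear 1ᵍ eq (solve (f ∷ x ∷ Y ∷ z ∷ []) ring)
      -- This supplies z ≠ 0, which the extraction of square roots asks for.
      odd-zz : Odd (z * z)
      odd-zz = subst Odd ST≡zz (odd-* (≡1[2]⇒odd (k + iᵍ * f * (Y * Y)) S≡1+2m)
                                      (≡1[2]⇒odd (k + - (iᵍ * f * (Y * Y))) T≡1+2n))
      cop-ST : Coprime (x * x + f * (π * Y * (π * Y))) (x * x + - (f * (π * Y * (π * Y))))
      cop-ST = coprime-x²±fy² f (f * f * f) x (π * Y) (k + iᵍ * f * (Y * Y))
        (linear 1ᵍ f⁴≡1 (solve (f ∷ []) ring)) cop S≡1+2m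
  in
  case ≡1[2]⇒squares (k + iᵍ * f * (Y * Y)) (x * x + f * (π * Y * (π * Y))) (x * x + - (f * (π * Y * (π * Y)))) z
         (odd≢0 (odd-sqrt z odd-zz)) cop-ST ST≡zz S≡1+2m of λ { (squareRoots r s S≡rr T≡ss) →
  pythagorean⇒smaller f x Y f⁴≡1 Y≢0 odd-x
    (roots⇒pythagorean f x Y r s S≡rr T≡ss (coprime-sqrt (subst₂ Coprime S≡rr T≡ss cop-ST))) } }

±1-square : ∀ {e} → e ≡ 1ᵍ ⊎ e ≡ - 1ᵍ → e * e ≡ 1ᵍ
±1-square (inj₁ refl) = refl
±1-square (inj₂ refl) = refl

±1-odd : ∀ {e} → e ≡ 1ᵍ ⊎ e ≡ - 1ᵍ → Odd e
±1-odd (inj₁ refl) = 0ᵍ , refl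
±1-odd (inj₂ refl) = - 1ᵍ + iᵍ , refl

-- For e = 1, z² changes sides and -z² = (i z)²; for e = -1 the equation is x⁴ + y⁴ = z², symmetric
-- in x and y.
swap : ∀ {e} x y z → e ≡ 1ᵍ ⊎ e ≡ - 1ᵍ → x * x * (x * x) ≡ z * z + e * (y * y * (y * y)) →
  ∃ λ w → y * y * (y * y) ≡ w * w + e * (x * x * (x * x))
swap x y z (inj₁ refl) eq = iᵍ * z , linear (- 1ᵍ) eq (solve (x ∷ y ∷ z ∷ []) ring)
swap x y z (inj₂ refl) eq = z , linear 1ᵍ eq (solve (x ∷ y ∷ z ∷ []) ring)

odd-fourth : ∀ {x} → Odd x → Odd (x * x * (x * x))
odd-fourth o = odd-* (odd-* o o) (odd-* o o)

-- Modulo π the equation would read 1 = 1 + 1.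
not-all-odd : ∀ {e} x y z → Odd e → x * x * (x * x) ≡ z * z + e * (y * y * (y * y)) →
  Odd x → Odd y → ¬ Odd z
not-all-odd {e} x y z odd-e eq odd-x odd-y odd-z =
  case odd-* odd-z odd-z of λ { (c , zz≡) →
  case odd-* odd-e (odd-fourth odd-y) of λ { (d , ey⁴≡) →
  even⇒¬odd {x * x * (x * x)} (- iᵍ * π + c + d , linear 1ᵍ eq (linear 1ᵍ zz≡ (linear 1ᵍ ey⁴≡ (solve (e ∷ x ∷ y ∷ z ∷ c ∷ d ∷ []) ring))))
    (odd-fourth odd-x) } }

-- The inequality is strict even for a unit `g`, because π has norm 2.
norm-cofactor-< : ∀ g y Y → Y ≢ 0ᵍ → g * (π * y) ≡ Y → norm y ℕ.< norm Y
norm-cofactor-< g y Y Y≢0 refl = begin-strict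
  norm y                             <⟨ ℕ.m<m+n (norm y) (norm>0 (*-factorʳ-≢0 π y (*-factorʳ-≢0 g (π * y) Y≢0))) ⟩
  norm y ℕ.+ norm y                  ≡⟨ cong (norm y ℕ.+_) (ℕ.+-identityʳ (norm y)) ⟨
  2 ℕ.* norm y                       ≡⟨ norm-* π y ⟨
  norm (π * y)                       ≤⟨ ℕ.m≤n*m (norm (π * y)) (norm g) {{ℕ.>-nonZero (norm>0 (*-factorˡ-≢0 g (π * y) Y≢0))}} ⟩
  norm g ℕ.* norm (π * y)            ≡⟨ norm-* g (π * y) ⟨
  norm (g * (π * y))                 ∎
  where open ℕ.≤-Reasoning

-- Infinite descent on the norm of `Y`: exactly one of g and h is even, and it is π times the next
-- `Y`. If that one is g, `swap` restores the shape of the equation.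
no-odd-even-solution : ∀ f → f * f ≡ 1ᵍ ⊎ f * f ≡ - 1ᵍ → ∀ x Y z → Acc ℕ._<_ (norm Y) →
  Odd x → Y ≢ 0ᵍ → Coprime x (π * Y) →
  x * x * (x * x) ≢ z * z + f * f * (π * Y * (π * Y) * (π * Y * (π * Y)))
no-odd-even-solution f ff≡±1 x Y z (acc rec) odd-x Y≢0 cop eq =
  case descent-step f x Y z (±1-square ff≡±1) odd-x Y≢0 cop eq of λ { (smaller g h w gh≡Y cop-gh odd-w eq′) →
  case even-or-odd g of λ where
    (inj₁ even-g) → case even-or-odd h of λ where
      (inj₁ even-h) → coprime⇒¬even cop-gh even-g even-h
      (inj₂ odd-h) → continue h g (trans (*ᵍ-comm h g) gh≡Y) (coprime-sym cop-gh) odd-h even-g (swap g h w ff≡±1 eq′)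
    (inj₂ odd-g) → case even-or-odd h of λ where
      (inj₁ even-h) → continue g h gh≡Y cop-gh odd-g even-h (w , eq′)
      (inj₂ odd-h) → not-all-odd g h w (±1-odd ff≡±1) eq′ odd-g odd-h odd-w }
  where
  continue : ∀ g h → g * h ≡ Y → Coprime g h → Odd g → Even h →
    (∃ λ w → g * g * (g * g) ≡ w * w + f * f * (h * h * (h * h))) → ⊥
  continue g h gh≡Y cop-gh odd-g (y , refl) (w , eq′) =
    no-odd-even-solution f ff≡±1 g y w (rec (norm-cofactor-< g y Y Y≢0 gh≡Y)) odd-g
      (*-factorʳ-≢0 π y (*-factorʳ-≢0 g (π * y) (Y≢0 ∘ trans (sym gh≡Y)))) cop-gh eq′

-- The case of odd x and y.

odd-fourth-mod-4 : ∀ {x} → Odd x → ∃ λ k → x * x * (x * x) ≡ 1ᵍ + 2ᵍ * 2ᵍ * k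
odd-fourth-mod-4 {x} odd-x = case odd-square odd-x of λ { (k , xx≡) →
  k + k * k , (x * x * (x * x) ≡ 1ᵍ + 2ᵍ * 2ᵍ * (k + k * k) ∋
    linear (x * x + (1ᵍ + 2ᵍ * k)) xx≡ (solve (x ∷ k ∷ []) ring)) }

-- The sum is 2 modulo 4, so z² = 2 (1 + 2 n) and z = π w with i w² = 1 + 2 n. Then w is odd, w² is
-- 1 modulo 2, and i would be 1 modulo 2.
odd-odd-sum : ∀ x y z → Odd x → Odd y → x * x * (x * x) + y * y * (y * y) ≢ z * z
odd-odd-sum x y z odd-x odd-y eq =
  case odd-fourth-mod-4 odd-x of λ { (k , x⁴≡) →
  case odd-fourth-mod-4 odd-y of λ { (l , y⁴≡) →
  let zz≡ : z * z ≡ 2ᵍ * (1ᵍ + 2ᵍ * (k + l))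
      zz≡ = linear (- 1ᵍ) eq (linear 1ᵍ x⁴≡ (linear 1ᵍ y⁴≡ (solve (x ∷ y ∷ z ∷ k ∷ l ∷ []) ring)))
      even-zz : Even (z * z)
      even-zz = - iᵍ * π * (1ᵍ + 2ᵍ * (k + l)) , linear 1ᵍ zz≡ (solve (z ∷ k ∷ l ∷ []) ring)
  in case even-sqrt z even-zz of λ { (w , z≡πw) →
  let iww≡ : iᵍ * (w * w) ≡ 1ᵍ + 2ᵍ * (k + l)
      iww≡ = *-cancelˡ 2ᵍ (iᵍ * (w * w)) (1ᵍ + 2ᵍ * (k + l)) (λ ())
        (linear 1ᵍ zz≡ (linear (- (z + π * w)) z≡πw (solve (z ∷ w ∷ k ∷ l ∷ []) ring)))
      odd-ww : Odd (w * w)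
      odd-ww = subst Odd (iᵍ * (iᵍ * (iᵍ * (iᵍ * (w * w)))) ≡ w * w ∋ solve (w ∷ []) ring)
        (odd-i* (odd-i* (odd-i* (≡1[2]⇒odd (k + l) iww≡))))
  in case odd-square (odd-sqrt w odd-ww) of λ { (n , ww≡) →
  i≢1[2] n (k + l) (linear 1ᵍ iww≡ (linear (- iᵍ) ww≡ (solve (w ∷ n ∷ k ∷ l ∷ []) ring))) } } } }

-- Modulo x, z² is -y⁴, which is prime to x.
coprime-fourth-difference : ∀ x y z → Coprime x y → x * x * (x * x) ≡ z * z + y * y * (y * y) → Coprime x z
coprime-fourth-difference x y z cop eq = coprime-factorˡ z z
  (coprime-shift {x} { - 1ᵍ * (y * y * (y * y))} {z * z} (x * x * x)
    (coprime-*ʳ {x} { - 1ᵍ} {y * y * (y * y)} (coprime-unit (- 1ᵍ) (- 1ᵍ) refl)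
      (coprime-*ʳ {x} {y * y} {y * y} (coprime-*ʳ cop cop) (coprime-*ʳ cop cop)))
    (linear (- 1ᵍ) eq (solve (x ∷ y ∷ z ∷ []) ring)))

-- If x⁴ - y⁴ = z² then 4(xy)⁴ = (x⁴ + y⁴)² - z⁴. Here z = (1 + i)² v and (1 + i)⁴ = -4, so that
-- (xy)⁴ = ((x⁴ + y⁴) / 2)² + ((1 + i) v)⁴.
odd-odd-difference : ∀ x y z → Odd x → Odd y → Coprime x y → z ≢ 0ᵍ →
  x * x * (x * x) ≢ z * z + y * y * (y * y)
odd-odd-difference x y z odd-x odd-y cop z≢0 eq =
  case odd-fourth-mod-4 odd-x of λ { (k , x⁴≡) →
  case odd-fourth-mod-4 odd-y of λ { (l , y⁴≡) →
  let zz≡ : z * z ≡ 2ᵍ * 2ᵍ * (k + - l)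
      zz≡ = linear (- 1ᵍ) eq (linear 1ᵍ x⁴≡ (linear (- 1ᵍ) y⁴≡ (solve (x ∷ y ∷ z ∷ k ∷ l ∷ []) ring)))
      even-zz : Even (z * z)
      even-zz = - (π * π * π) * (k + - l) , linear 1ᵍ zz≡ (solve (z ∷ k ∷ l ∷ []) ring)
  in case even-sqrt z even-zz of λ { (w , z≡πw) →
  let ww≡ : w * w ≡ π * (- π * (k + - l))
      ww≡ = *-cancelˡ (2ᵍ * iᵍ) (w * w) (π * (- π * (k + - l))) (λ ())
        (linear 1ᵍ zz≡ (linear (- (z + π * w)) z≡πw (solve (z ∷ w ∷ k ∷ l ∷ []) ring)))
  in case even-sqrt w (- π * (k + - l) , ww≡) of λ { (v , w≡πv) →
  let z≡ππv : z ≡ π * (π * v)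
      z≡ππv = trans z≡πw (cong (π *_) w≡πv)
      v≢0 : v ≢ 0ᵍ
      v≢0 = *-factorʳ-≢0 π v (*-factorʳ-≢0 π (π * v) (z≢0 ∘ trans z≡ππv))
      -- Exchanging x and y changes the sign of z², hence i z.
      cop-yz : Coprime y (iᵍ * z)
      cop-yz = coprime-fourth-difference y x (iᵍ * z) (coprime-sym cop)
        (linear (- 1ᵍ) eq (solve (x ∷ y ∷ z ∷ []) ring))
      cop-xy-z : Coprime (x * y) z
      cop-xy-z = coprime-sym (coprime-*ʳ (coprime-sym (coprime-fourth-difference x y z cop eq))
        (coprime-sym (coprime-factorʳ iᵍ z cop-yz)))
      cop-xy-πv : Coprime (x * y) (π * v)
      cop-xy-πv = coprime-factorʳ π (π * v) (subst (Coprime (x * y)) z≡ππv cop-xy-z)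
      vv≡ : v * v ≡ l + - k
      vv≡ = *-cancelˡ (π * π) (v * v) (l + - k) (λ ())
        (linear 1ᵍ ww≡ (linear (- (w + π * v)) w≡πv (solve (w ∷ v ∷ k ∷ l ∷ []) ring)))
      -- Here (x⁴ + y⁴) / 2 = 1 + 2 (k + l), and v² = l - k gives (π v)⁴ = -4 (k - l)².
      x⁴y⁴≡ : (1ᵍ + 2ᵍ * 2ᵍ * k) * (1ᵍ + 2ᵍ * 2ᵍ * l) ≡
        (1ᵍ + 2ᵍ * (k + l)) * (1ᵍ + 2ᵍ * (k + l)) + 1ᵍ * 1ᵍ * (π * v * (π * v) * (π * v * (π * v)))
      x⁴y⁴≡ = linear (2ᵍ * 2ᵍ * (v * v + (l + - k))) vv≡ (solve (v ∷ k ∷ l ∷ []) ring)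
      [xy]⁴≡ : x * y * (x * y) * (x * y * (x * y)) ≡ x * x * (x * x) * (y * y * (y * y))
      [xy]⁴≡ = solve (x ∷ y ∷ []) ring
  in no-odd-even-solution 1ᵍ (inj₁ refl) (x * y) v (1ᵍ + 2ᵍ * (k + l)) (<-wellFounded (norm v))
       (odd-* odd-x odd-y) v≢0 cop-xy-πv (trans [xy]⁴≡ (trans (cong₂ _*_ x⁴≡ y⁴≡) x⁴y⁴≡)) } } } }

-- The condition on `z` is tied to f² = 1 because x = y = 1, z = 0 solves that equation.
no-coprime-solution : ∀ f → f * f ≡ 1ᵍ ⊎ f * f ≡ - 1ᵍ → ∀ x y z → Coprime x y → y ≢ 0ᵍ → x ≢ 0ᵍ →
  (f * f ≡ 1ᵍ → z ≢ 0ᵍ) → x * x * (x * x) ≢ z * z + f * f * (y * y * (y * y))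
no-coprime-solution f ff≡±1 x y z cop y≢0 x≢0 z≢0 eq = case even-or-odd x of λ where
    (inj₁ even-x) → case even-or-odd y of λ where
      (inj₁ even-y) → coprime⇒¬even cop even-x even-y
      (inj₂ odd-y) → odd-even y x (coprime-sym cop) odd-y even-x x≢0 (swap x y z ff≡±1 eq)
    (inj₂ odd-x) → case even-or-odd y of λ where
      (inj₁ even-y) → odd-even x y cop odd-x even-y y≢0 (z , eq)
      (inj₂ odd-y) → case ff≡±1 of λ where
        (inj₁ ff≡1) → odd-odd-difference x y z odd-x odd-y cop (z≢0 ff≡1)
          (linear 1ᵍ eq (linear (y * y * (y * y)) ff≡1 (solve (f ∷ x ∷ y ∷ z ∷ []) ring)))
        (inj₂ ff≡-1) → odd-odd-sum x y z odd-x odd-y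
          (linear 1ᵍ eq (linear (y * y * (y * y)) ff≡-1 (solve (f ∷ x ∷ y ∷ z ∷ []) ring)))
  where
  odd-even : ∀ x y → Coprime x y → Odd x → Even y → y ≢ 0ᵍ →
    (∃ λ z → x * x * (x * x) ≡ z * z + f * f * (y * y * (y * y))) → ⊥
  odd-even x y cop odd-x (Y , refl) y≢0 (z , eq) =
    no-odd-even-solution f ff≡±1 x Y z (<-wellFounded (norm Y)) odd-x (*-factorʳ-≢0 π Y y≢0) cop eq

-- For g the gcd of x and y, g⁴ divides z², so g² divides z and the whole equation can be divided by
-- g⁴.
no-solution : ∀ f → f * f ≡ 1ᵍ ⊎ f * f ≡ - 1ᵍ → ∀ x y z → x ≢ 0ᵍ → y ≢ 0ᵍ →
  (f * f ≡ 1ᵍ → z ≢ 0ᵍ) → x * x * (x * x) ≢ z * z + f * f * (y * y * (y * y))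
no-solution f ff≡±1 x y z x≢0 y≢0 z≢0 eq =
  case coprime-parts x y x≢0 of λ { (g , a , b , x≡ga , y≡gb , g≢0 , cop) →
  let g⁴∣zz : g * g * (g * g) * (a * a * (a * a) + - (f * f * (b * b * (b * b)))) ≡ z * z
      g⁴∣zz = cofactor g a b x≡ga y≡gb
  in case square-∣⇒∣ (g * g) (a * a * (a * a) + - (f * f * (b * b * (b * b)))) z (*-≢0 g≢0 g≢0) g⁴∣zz of λ { (c , z≡ggc) →
  no-coprime-solution f ff≡±1 a b c cop
    (*-factorʳ-≢0 g b (y≢0 ∘ trans y≡gb)) (*-factorʳ-≢0 g a (x≢0 ∘ trans x≡ga))
    (λ ff≡1 → *-factorʳ-≢0 (g * g) c (z≢0 ff≡1 ∘ trans z≡ggc))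
    (*-cancelˡ (g * g * (g * g)) (a * a * (a * a)) (c * c + f * f * (b * b * (b * b))) (*-≢0 (*-≢0 g≢0 g≢0) (*-≢0 g≢0 g≢0))
      (linear 1ᵍ g⁴∣zz (linear (z + g * g * c) z≡ggc (solve (f ∷ z ∷ g ∷ a ∷ b ∷ c ∷ []) ring)))) } }
  where
  cofactor : ∀ g a b → x ≡ g * a → y ≡ g * b →
    g * g * (g * g) * (a * a * (a * a) + - (f * f * (b * b * (b * b)))) ≡ z * z
  cofactor g a b refl refl = linear 1ᵍ eq (solve (f ∷ z ∷ g ∷ a ∷ b ∷ []) ring)

-- The two equations with coefficient i.

fourth-difference : ∀ x y z → x * x * (x * x) + - (y * y * (y * y)) ≡ iᵍ * (z * z) → x * y * z ≡ 0ᵍ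
fourth-difference x y z eq = case (x * y * z) ≟ᵍ 0ᵍ of λ where
  (yes xyz≡0) → xyz≡0
  -- Squaring the equation gives z⁴ = -(x⁴ - y⁴)² = -(x⁴ + y⁴)² + 4 (x y)⁴, and 4 = -π⁴ is the
  -- coefficient f² π⁴ for f = i.
  (no xyz≢0) → ⊥-elim (no-solution iᵍ (inj₂ refl) z (π * (x * y)) (iᵍ * (x * x * (x * x) + y * y * (y * y)))
    (*-factorʳ-≢0 (x * y) z xyz≢0) (*-≢0 {π} (λ ()) (*-factorˡ-≢0 (x * y) z xyz≢0)) (λ ())
    (linear (x * x * (x * x) + - (y * y * (y * y)) + iᵍ * (z * z)) eq (solve (x ∷ y ∷ z ∷ []) ring)))

square-roots : ∀ x y → x * x ≡ y * y → x ≡ y ⊎ x ≡ - y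
square-roots x y eq = case *-zero-product (x + - y) (x + y) (linear 1ᵍ eq (solve (x ∷ y ∷ []) ring)) of λ where
  (inj₁ p) → inj₁ (x ≡ y ∋ linear 1ᵍ p (solve (x ∷ y ∷ []) ring))
  (inj₂ p) → inj₂ (x ≡ - y ∋ linear 1ᵍ p (solve (x ∷ y ∷ []) ring))

equal-fourths : ∀ x y → x * x * (x * x) ≡ y * y * (y * y) → ∃ λ u → x ≡ y * u
equal-fourths x y x⁴≡y⁴ = case square-roots (x * x) (y * y) x⁴≡y⁴ of λ where
  (inj₁ xx≡yy) → case square-roots x y xx≡yy of λ where
    (inj₁ x≡y) → 1ᵍ , (x ≡ y * 1ᵍ ∋ linear 1ᵍ x≡y (solve (x ∷ y ∷ []) ring))
    (inj₂ x≡-y) → - 1ᵍ , (x ≡ y * - 1ᵍ ∋ linear 1ᵍ x≡-y (solve (x ∷ y ∷ []) ring))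
  (inj₂ xx≡-yy) → case square-roots x (iᵍ * y) (linear 1ᵍ xx≡-yy (solve (x ∷ y ∷ []) ring)) of λ where
    (inj₁ x≡iy) → iᵍ , (x ≡ y * iᵍ ∋ linear 1ᵍ x≡iy (solve (x ∷ y ∷ []) ring))
    (inj₂ x≡-iy) → - iᵍ , (x ≡ y * - iᵍ ∋ linear 1ᵍ x≡-iy (solve (x ∷ y ∷ []) ring))

fourthRoot-fourth : ∀ {u} → IsFourthRoot u → u * u * (u * u) ≡ 1ᵍ
fourthRoot-fourth (inj₁ (inj₁ refl)) = refl
fourthRoot-fourth (inj₁ (inj₂ refl)) = refl
fourthRoot-fourth (inj₂ (inj₁ refl)) = refl
fourthRoot-fourth (inj₂ (inj₂ refl)) = refl

-- The square of `iᵍ * π` is -2 i, the value of z² when x⁴ = y⁴ = 1.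
IsRootOf-2i : ℤ[i] → Set
IsRootOf-2i z = z ≡ iᵍ * π ⊎ z ≡ - (iᵍ * π)

-- (x⁴ + y⁴)² - 4(xy)⁴ = (x⁴ - y⁴)²
fourth-sum⇒equal-fourths : ∀ x y z → x * y * z ≢ 0ᵍ → x * x * (x * x) + y * y * (y * y) ≡ iᵍ * (z * z) →
  x * x * (x * x) ≡ y * y * (y * y)
fourth-sum⇒equal-fourths x y z xyz≢0 eq = case (x * x * (x * x) + - (y * y * (y * y))) ≟ᵍ 0ᵍ of λ where
    (yes d≡0) → x * x * (x * x) ≡ y * y * (y * y) ∋ linear 1ᵍ d≡0 (solve (x ∷ y ∷ []) ring)
    (no d≢0) → ⊥-elim (no-solution 1ᵍ (inj₁ refl) (π * (x * y)) z (x * x * (x * x) + - (y * y * (y * y)))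
      (*-≢0 {π} (λ ()) (*-factorˡ-≢0 (x * y) z xyz≢0)) (*-factorʳ-≢0 (x * y) z xyz≢0) (λ _ → d≢0)
      (linear (- (x * x * (x * x) + y * y * (y * y) + iᵍ * (z * z))) eq (solve (x ∷ y ∷ z ∷ []) ring)))

-- From x⁴ = y⁴ follow that y divides x and that z² = -2 i y⁴, so y² divides z. Thus y is a common
-- divisor of all three, hence a unit.
fourth-sum⇒y-root : ∀ x y z → y ≢ 0ᵍ → GcdOne₃ x y z → x * x * (x * x) ≡ y * y * (y * y) →
  x * x * (x * x) + y * y * (y * y) ≡ iᵍ * (z * z) → IsFourthRoot y
fourth-sum⇒y-root x y z y≢0 gcd≡1 x⁴≡y⁴ eq =
  case equal-fourths x y x⁴≡y⁴ of λ { (u , x≡yu) →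
  case square-∣⇒∣ (y * y) (- iᵍ * 2ᵍ) z (*-≢0 y≢0 y≢0)
         (linear iᵍ x⁴≡y⁴ (linear (- iᵍ) eq (solve (x ∷ y ∷ z ∷ []) ring))) of λ { (c , z≡yyc) →
  case gcd≡1 y (u , x≡yu) (1ᵍ , solve (y ∷ []) ring) (y * c , linear 1ᵍ z≡yyc (solve (y ∷ z ∷ c ∷ []) ring)) of λ { (v , 1≡yv) →
  unit⇒fourthRoot y v (sym 1≡yv) } } }

fourth-sum⇒ : ∀ x y z → x * y * z ≢ 0ᵍ → GcdOne₃ x y z → x * x * (x * x) + y * y * (y * y) ≡ iᵍ * (z * z) →
  IsFourthRoot x × IsFourthRoot y × IsRootOf-2i z
fourth-sum⇒ x y z xyz≢0 gcd≡1 eq = root-x , root-y , square-roots z (iᵍ * π) zz≡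
  where
  x⁴≡y⁴ : x * x * (x * x) ≡ y * y * (y * y)
  x⁴≡y⁴ = fourth-sum⇒equal-fourths x y z xyz≢0 eq
  root-y : IsFourthRoot y
  root-y = fourth-sum⇒y-root x y z (*-factorʳ-≢0 x y (*-factorˡ-≢0 (x * y) z xyz≢0)) gcd≡1 x⁴≡y⁴ eq
  y⁴≡1 : y * y * (y * y) ≡ 1ᵍ
  y⁴≡1 = fourthRoot-fourth root-y
  root-x : IsFourthRoot x
  root-x = unit⇒fourthRoot x (x * x * x) (linear 1ᵍ x⁴≡y⁴ (linear 1ᵍ y⁴≡1 (solve (x ∷ y ∷ []) ring)))
  zz≡ : z * z ≡ iᵍ * π * (iᵍ * π)
  zz≡ = linear iᵍ eq (linear (- iᵍ) x⁴≡y⁴ (linear (- (2ᵍ * iᵍ)) y⁴≡1 (solve (x ∷ y ∷ z ∷ []) ring)))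

fourth-sum⇐ : ∀ {x y z} → IsFourthRoot x → IsFourthRoot y → IsRootOf-2i z →
  x * x * (x * x) + y * y * (y * y) ≡ iᵍ * (z * z)
fourth-sum⇐ rx ry rz = trans (cong₂ _+_ (fourthRoot-fourth rx) (fourthRoot-fourth ry)) (sym (izz≡2 rz))
  where
  izz≡2 : ∀ {z} → IsRootOf-2i z → iᵍ * (z * z) ≡ 2ᵍ
  izz≡2 (inj₁ refl) = refl
  izz≡2 (inj₂ refl) = refl

theorem1 : (∀ (x y z : ℤ[i]) → x ⁴ᵍ -ᵍ y ⁴ᵍ ≡ iᵍ *ᵍ z ²ᵍ → x *ᵍ y *ᵍ z ≡ 0ᵍ)
    × (∀ (x y z : ℤ[i]) → x *ᵍ y *ᵍ z ≢ 0ᵍ → GcdOne₃ x y z →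
    (x ⁴ᵍ +ᵍ y ⁴ᵍ ≡ iᵍ *ᵍ z ²ᵍ)
    ⇔ (((x ≡ 1ᵍ ⊎ x ≡ -ᵍ 1ᵍ) ⊎ (x ≡ iᵍ ⊎ x ≡ -ᵍ iᵍ))
    × ((y ≡ 1ᵍ ⊎ y ≡ -ᵍ 1ᵍ) ⊎ (y ≡ iᵍ ⊎ y ≡ -ᵍ iᵍ))
    × (z ≡ iᵍ *ᵍ (1ᵍ +ᵍ iᵍ) ⊎ z ≡ -ᵍ (iᵍ *ᵍ (1ᵍ +ᵍ iᵍ)))))
theorem1 = fourth-difference , λ x y z xyz≢0 gcd≡1 →
  mk⇔ (fourth-sum⇒ x y z xyz≢0 gcd≡1) (λ (rx , ry , rz) → fourth-sum⇐ rx ry rz)
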